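{- Up to isomorphism, the only minimally $\gamma_g$-imperfect triangle-free graphs are the path $P_5$, the cycle $C_5$, and the six graphs $F_1,\dots,F_6$ of the family $\mathcal{F}$.
   Context: Graphs are finite, simple, undirected, with at least one vertex, not necessarily connected. $P_n$ and $C_n$ are the path and the cycle on $n$ vertices. $\gamma(G)$ is the domination number of $G$. Domination game on $G$: Dominator and Staller alternately select vertices; each selected vertex must dominate (i.e. contain in its closed neighborhood) at least one vertex not dominated by the previously selected vertices. The game ends when no legal move exists. Dominator wants to minimize and Staller to maximize the total number of moves. $\gamma_g(G)$ is the number of moves under optimal play when Dominator starts. $G$ is $\gamma_g$-perfect if every induced subgraph $F$ of $G$ satisfies $\gamma_g(F)=\gamma(F)$. $G$ is minimally $\gamma_g$-imperfect if each of its proper induced subgraphs is $\gamma_g$-perfect but $\gamma(G)<\gamma_g(G)$. The family $\mathcal{F}=\{F_1,\dots,F_6\}$ consists of the following bipartite graphs on six vertices: $F_1=2P_3$ (disjoint union of two copies of $P_3$); $F_2$ is the tree consisting of two adjacent vertices, each having two further leaf neighbors; $F_3$ is obtained from a 4-cycle by attaching one pendant vertex to each of two adjacent vertices of the cycle; $F_4$ is obtained from $K_{2,3}$ by attaching one pendant vertex to a vertex of degree $2$; $F_5$ is $K_{3,3}$ minus an edge; $F_6=K_{3,3}$. -}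

module Defs where

open import Data.Bool using (Bool; true; false; T; _∧_; _∨_; not)
open import Data.Bool.Properties using (∨-comm)
open import Data.Fin using (Fin; toℕ; _≟_)
open import Data.Fin.Patterns using (0F; 1F; 2F; 3F; 4F; 5F)
open import Data.Fin.Permutation using (Permutation; _⟨$⟩ʳ_)
open import Data.Fin.Properties using (any?; all?)
open import Data.Fin.Subset using (Subset; _∈_; _∉_; _∪_; ∣_∣; inside; outside) renaming (⊥ to ∅)
open import Data.Fin.Subset.Properties using (_∈?_)
open import Data.List using (List; []; _∷_; [_]; map; _++_; filter; allFin)
open import Data.List.Extrema.Nat using (min; max)
open import Data.List.Membership.DecPropositional using () renaming (_∈?_ to mem?)
open import Data.Nat using (ℕ; zero; suc; _<_; NonZero)
open import Data.Nat.DivMod using (_%_)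
open import Data.Nat.Properties using () renaming (_≟_ to _≟ℕ_)
open import Data.Product using (∃; Σ-syntax; _×_; _,_)
open import Data.Product.Properties using (≡-dec)
import Data.Vec as Vec
open import Function using (_↣_; module Injection)
open import Relation.Binary.PropositionalEquality using (_≡_; refl; sym; cong₂)
open import Relation.Nullary using (Dec; does; ¬_; ¬?; yes; no; contradiction)
open import Relation.Nullary.Decidable using (_×-dec_)

private
  variable
    m n : ℕ

record Graph (n : ℕ) : Set where
  field
    adj        : Fin n → Fin n → Bool
    adj-sym    : ∀ u v → adj u v ≡ adj v u
    adj-irrefl : ∀ v → adj v v ≡ false

  Adj : Fin n → Fin n → Set
  Adj u v = T (adj u v)

open Graph public

infix 4 _≅_

_≅_ : Graph m → Graph n → Set
_≅_ {m} {n} G H =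
  Σ[ π ∈ Permutation m n ] (∀ u v → adj G u v ≡ adj H (π ⟨$⟩ʳ u) (π ⟨$⟩ʳ v))

-- The subgraph induced by the image of ι, with vertices renamed along ι.
-- As ι ranges over all injections this gives every induced subgraph (each
-- one up to the labelling of its vertices); it is proper iff m < n.
induced : Graph n → (Fin m ↣ Fin n) → Graph m
induced G ι = record
  { adj        = λ u v → adj G (to u) (to v)
  ; adj-sym    = λ u v → adj-sym G (to u) (to v)
  ; adj-irrefl = λ v → adj-irrefl G (to v)
  }
  where open Injection ι using (to)

TriangleFree : Graph n → Set
TriangleFree G = ∀ u v w → ¬ (Adj G u v × Adj G v w × Adj G u w)

N[_] : Graph n → Fin n → Subset n
N[ G ] v = Vec.tabulate (λ w → does (v ≟ w) ∨ adj G v w)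

Dominating : Graph n → Subset n → Set
Dominating G S = ∀ v → ∃ λ u → u ∈ S × v ∈ N[ G ] u

dominating? : (G : Graph n) (S : Subset n) → Dec (Dominating G S)
dominating? G S = all? λ v → any? λ u → (u ∈? S) ×-dec (v ∈? N[ G ] u)

allSubsets : ∀ n → List (Subset n)
allSubsets zero    = [ Vec.[] ]
allSubsets (suc n) =
  map (inside Vec.∷_) (allSubsets n) ++ map (outside Vec.∷_) (allSubsets n)

-- The default value n is harmless: the full vertex set is dominating.
γ : Graph n → ℕ
γ {n} G = min n (map ∣_∣ (filter (dominating? G) (allSubsets n)))

data Player : Set where
  Dominator Staller : Player

opponent : Player → Player
opponent Dominator = Staller
opponent Staller   = Dominator

-- The best of x ∷ xs from the point of view of the given player.
optimum : Player → ℕ → List ℕ → ℕ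
optimum Dominator = min
optimum Staller   = max

-- D is the set of vertices dominated by the moves made so far.
Legal : Graph n → Subset n → Fin n → Set
Legal G D v = ∃ λ w → w ∈ N[ G ] v × w ∉ D

legal? : (G : Graph n) (D : Subset n) (v : Fin n) → Dec (Legal G D v)
legal? G D v = any? λ w → (w ∈? N[ G ] v) ×-dec ¬? (w ∈? D)

legalMoves : Graph n → Subset n → List (Fin n)
legalMoves {n} G D = filter (legal? G D) (allFin n)

-- The number of moves still to be made under optimal play when p is to move
-- and D is dominated.  The first argument bounds the length of the game and
-- only serves termination: every move dominates a new vertex, so any bound
-- that is at least the number of undominated vertices gives the same value.
mutual
  movesLeft : ℕ → Graph n → Player → Subset n → ℕ
  movesLeft zero    G p D = 0
  movesLeft (suc k) G p D = bestMove k G p D (legalMoves G D)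

  bestMove : ℕ → Graph n → Player → Subset n → List (Fin n) → ℕ
  bestMove k G p D []       = 0
  bestMove k G p D (v ∷ vs) = suc (optimum p (after v) (map after vs))
    where
    after : _ → ℕ
    after u = movesLeft k G (opponent p) (D ∪ N[ G ] u)

γg : Graph n → ℕ
γg {n} G = movesLeft n G Dominator ∅

Perfect : Graph n → Set
Perfect {n} G =
  ∀ {m} .{{_ : NonZero m}} (ι : Fin m ↣ Fin n) → γg (induced G ι) ≡ γ (induced G ι)

MinimallyImperfect : Graph n → Set
MinimallyImperfect {n} G =
  (∀ {m} .{{_ : NonZero m}} (ι : Fin m ↣ Fin n) → m < n → Perfect (induced G ι))
  × γ G < γg G

-- The graph in which distinct u and v are adjacent iff e u v or e v u holds.
symmetrise : (Fin n → Fin n → Bool) → Graph n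
symmetrise e = record
  { adj        = λ u v → not (does (u ≟ v)) ∧ (e u v ∨ e v u)
  ; adj-sym    = λ u v → cong₂ (λ a b → not a ∧ b) (does-≟-sym u v) (∨-comm (e u v) (e v u))
  ; adj-irrefl = irr
  }
  where
  does-≟-sym : ∀ {n} (u v : Fin n) → does (u ≟ v) ≡ does (v ≟ u)
  does-≟-sym u v with u ≟ v | v ≟ u
  ... | yes _   | yes _   = refl
  ... | no  _   | no  _   = refl
  ... | yes u≡v | no  v≢u = contradiction (sym u≡v) v≢u
  ... | no  u≢v | yes v≡u = contradiction (sym v≡u) u≢v

  irr : ∀ v → not (does (v ≟ v)) ∧ (e v v ∨ e v v) ≡ false
  irr v with v ≟ v
  ... | yes _   = refl
  ... | no  v≢v = contradiction refl v≢v

path : ∀ n → Graph n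
path n = symmetrise λ i j → does (toℕ j ≟ℕ suc (toℕ i))

-- This is the cycle on n vertices only when 3 ≤ n.
cycle : ∀ n .{{_ : NonZero n}} → Graph n
cycle n = symmetrise λ i j → does (toℕ j ≟ℕ suc (toℕ i) % n)

fromEdges : List (Fin n × Fin n) → Graph n
fromEdges es = symmetrise λ u v → does (mem? (≡-dec _≟_ _≟_) (u , v) es)

-- 2P₃: the paths 0-1-2 and 3-4-5.
F₁ : Graph 6
F₁ = fromEdges ((0F , 1F) ∷ (1F , 2F) ∷ (3F , 4F) ∷ (4F , 5F) ∷ [])

-- Adjacent vertices 0 and 1, with leaves 2, 3 at 0 and leaves 4, 5 at 1.
F₂ : Graph 6
F₂ = fromEdges ((0F , 1F) ∷ (0F , 2F) ∷ (0F , 3F) ∷ (1F , 4F) ∷ (1F , 5F) ∷ [])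

-- The 4-cycle 0-1-2-3, with pendant vertices 4 at 0 and 5 at 1.
F₃ : Graph 6
F₃ = fromEdges
  ((0F , 1F) ∷ (1F , 2F) ∷ (2F , 3F) ∷ (3F , 0F) ∷ (0F , 4F) ∷ (1F , 5F) ∷ [])

-- K₂,₃ with parts {0, 1} and {2, 3, 4}, with pendant vertex 5 at 2.
F₄ : Graph 6
F₄ = fromEdges
  ( (0F , 2F) ∷ (0F , 3F) ∷ (0F , 4F)
  ∷ (1F , 2F) ∷ (1F , 3F) ∷ (1F , 4F)
  ∷ (2F , 5F) ∷ [])

-- K₃,₃ with parts {0, 1, 2} and {3, 4, 5}, minus the edge between 2 and 5.
F₅ : Graph 6
F₅ = fromEdges
  ( (0F , 3F) ∷ (0F , 4F) ∷ (0F , 5F)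
  ∷ (1F , 3F) ∷ (1F , 4F) ∷ (1F , 5F)
  ∷ (2F , 3F) ∷ (2F , 4F) ∷ [])

-- K₃,₃ with parts {0, 1, 2} and {3, 4, 5}.
F₆ : Graph 6
F₆ = fromEdges
  ( (0F , 3F) ∷ (0F , 4F) ∷ (0F , 5F)
  ∷ (1F , 3F) ∷ (1F , 4F) ∷ (1F , 5F)
  ∷ (2F , 3F) ∷ (2F , 4F) ∷ (2F , 5F) ∷ [])

ℱ : Fin 6 → Graph 6
ℱ 0F = F₁
ℱ 1F = F₂
ℱ 2F = F₃
ℱ 3F = F₄
ℱ 4F = F₅
ℱ 5F = F₆

{-# OPTIONS --safe #-}

-- Let G be triangle-free without induced copies of the eight graphs, and let Dominator start at a
-- vertex x of maximum degree.  Among the vertices far from x (outside N[x]), an edge forms a whole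
-- component, and at most one far vertex has a neighbour in N(x): otherwise the maximality of x
-- supplies the neighbours of x that complete an induced P₅, C₅ or Fᵢ.  Hence the sets N[v] ∖ N[x]
-- are pairwise equal or disjoint, so every later move makes a vertex of any fixed set covering the
-- far vertices useless, and the game lasts at most as long as that set is large.  A minimum
-- dominating set still covers the far vertices after the removal of a suitable vertex, so γg ≤ γ.
--
-- Thus a minimally imperfect G contains one of the eight graphs, which are imperfect, and must be
-- equal to it.  Conversely, proper induced subgraphs of the eight graphs contain none of them,
-- hence are perfect.

module Submission where

open import Defs
open import Data.Bool using (Bool; true; false; T; _∨_)
open import Data.Bool.Properties using (T?; T-≡; ∨-identityʳ) renaming (_≟_ to _≟ᵇ_)
open import Data.Empty using (⊥; ⊥-elim)
open import Data.Fin using (Fin; zero; suc; toℕ; _≟_)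
open import Data.Fin.Patterns using (0F; 1F; 2F; 3F; 4F; 5F)
open import Data.Fin.Permutation
  using (Permutation; permutation; _⟨$⟩ʳ_; _⟨$⟩ˡ_; inverseˡ; inverseʳ; ↔⇒≡)
  renaming (flip to flipₚ; id to idₚ)
open import Data.Fin.Properties using (any?; all?; <-cmp; punchOut-injective; injective⇒≤)
open import Data.Fin.Subset
  using (Subset; _∈_; _∉_; _⊆_; _⊂_; _∪_; _-_; ∁; ⁅_⁆; ∣_∣; inside; outside)
  renaming (⊥ to ∅; ⊤ to full)
open import Data.Fin.Subset.Properties
open import Data.List using (List; []; _∷_; map; length; foldr; filter; allFin)
open import Data.List.Extrema.Nat
  using (argmax; argmin-sel; argmax-sel; min≤xs; min≤⊤; xs≤max; ⊥≤max; f[xs]≤f[argmax])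
open import Data.List.Membership.DecPropositional using () renaming (_∈?_ to mem?)
open import Data.List.Membership.Propositional using () renaming (_∈_ to _∈ˡ_)
open import Data.List.Membership.Propositional.Properties
  using (∈-map⁺; ∈-map⁻; ∈-++⁺ˡ; ∈-++⁺ʳ; ∈-filter⁺; ∈-filter⁻; ∈-allFin)
open import Data.List.Relation.Unary.All as All using (All; []; _∷_)
open import Data.List.Relation.Unary.AllPairs using ([]; _∷_)
open import Data.List.Relation.Unary.Any using (here; there)
open import Data.List.Relation.Unary.Unique.Propositional using (Unique)
open import Data.Nat using (ℕ; zero; suc; _≤_; _<_; _+_; _<ᵇ_; _<?_; z≤n; s≤s; NonZero)
open import Data.Nat.Properties
  using (≤-refl; ≤-reflexive; ≤-trans; <-≤-trans; ≤-<-trans; ≤-antisym; m≤n⇒m<n∨m≡n; <⇒≱;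
    <-irrefl; n≤1+n; +-suc; +-monoʳ-≤; <⇒<ᵇ)
open import Data.Product using (∃; Σ-syntax; _×_; _,_; proj₁; proj₂)
open import Data.Product.Properties using (≡-dec)
open import Data.Sum as Sum using (_⊎_; inj₁; inj₂)
open import Data.Vec
  using (Vec; []; _∷_; lookup; tabulate)
  renaming (here to hereᵛ; there to thereᵛ)
open import Data.Vec.Properties using (lookup∘tabulate; lookup⇒[]=; []=⇒lookup)
open import Function using (_∘_; _⇔_; _↣_; mk⇔; mk↣; module Injection; module Equivalence)
open import Function.Construct.Composition using (_↣-∘_)
open import Function.Construct.Identity using (↣-id)
open import Function.Properties.Inverse using (↔⇒↣)
open import Relation.Binary.Definitions using (tri<; tri≈; tri>)
open import Relation.Binary.PropositionalEquality
open import Relation.Nullary using (Dec; does; yes; no; ¬_; ¬?; contradiction)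
open import Relation.Nullary.Decidable
  using (_×-dec_; _⊎-dec_; _→-dec_; from-yes; map′; decidable-stable)

private
  variable
    k m n : ℕ

T⇒true : ∀ {b} → T b → b ≡ true
T⇒true = Equivalence.to T-≡

¬T⇒false : ∀ {b} → ¬ T b → b ≡ false
¬T⇒false {true}  ¬b = ⊥-elim (¬b _)
¬T⇒false {false} _  = refl

-- Cardinalities of subsets

∣p∪q∣≤∣p∣+∣q∣ : ∀ (p q : Subset n) → ∣ p ∪ q ∣ ≤ ∣ p ∣ + ∣ q ∣
∣p∪q∣≤∣p∣+∣q∣ []            []            = z≤n
∣p∪q∣≤∣p∣+∣q∣ (outside ∷ p) (outside ∷ q) = ∣p∪q∣≤∣p∣+∣q∣ p q
∣p∪q∣≤∣p∣+∣q∣ (outside ∷ p) (inside ∷ q)  =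
  ≤-trans (s≤s (∣p∪q∣≤∣p∣+∣q∣ p q)) (≤-reflexive (sym (+-suc ∣ p ∣ ∣ q ∣)))
∣p∪q∣≤∣p∣+∣q∣ (inside ∷ p)  (outside ∷ q) = s≤s (∣p∪q∣≤∣p∣+∣q∣ p q)
∣p∪q∣≤∣p∣+∣q∣ (inside ∷ p)  (inside ∷ q)  =
  s≤s (≤-trans (∣p∪q∣≤∣p∣+∣q∣ p q) (+-monoʳ-≤ ∣ p ∣ (n≤1+n ∣ q ∣)))

∣⁅x⁆∪p∣≤1+∣p∣ : ∀ (x : Fin n) p → ∣ ⁅ x ⁆ ∪ p ∣ ≤ suc ∣ p ∣
∣⁅x⁆∪p∣≤1+∣p∣ x p =
  subst (λ c → ∣ ⁅ x ⁆ ∪ p ∣ ≤ c + ∣ p ∣) (∣⁅x⁆∣≡1 x) (∣p∪q∣≤∣p∣+∣q∣ ⁅ x ⁆ p)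

smaller⇒misses : ∀ (p q : Subset n) → ∣ q ∣ < ∣ p ∣ → ∃ λ z → z ∈ p × z ∉ q
smaller⇒misses p q q<p with any? (λ z → (z ∈? p) ×-dec ¬? (z ∈? q))
... | yes z  = z
... | no  ¬z = contradiction (p⊆q⇒∣p∣≤∣q∣ p⊆q) (<⇒≱ q<p)
  where
  p⊆q : p ⊆ q
  p⊆q {z} z∈p = decidable-stable (z ∈? q) λ z∉q → ¬z (z , z∈p , z∉q)

fromList : List (Fin n) → Subset n
fromList = foldr (λ x p → ⁅ x ⁆ ∪ p) ∅

∣fromList∣≤length : ∀ (xs : List (Fin n)) → ∣ fromList xs ∣ ≤ length xs
∣fromList∣≤length {n} [] = ≤-reflexive (∣⊥∣≡0 n)
∣fromList∣≤length (x ∷ xs) =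
  ≤-trans (∣⁅x⁆∪p∣≤1+∣p∣ x (fromList xs)) (s≤s (∣fromList∣≤length xs))

∉fromList⁻ : ∀ {z} (xs : List (Fin n)) → z ∉ fromList xs → All (z ≢_) xs
∉fromList⁻ []       _  = []
∉fromList⁻ (x ∷ xs) z∉ =
  (λ { refl → z∉ (x∈p∪q⁺ (inj₁ (x∈⁅x⁆ x))) }) ∷ ∉fromList⁻ xs (z∉ ∘ x∈p∪q⁺ ∘ inj₂)

fresh : ∀ (xs : List (Fin n)) p → length xs < ∣ p ∣ → ∃ λ z → z ∈ p × All (z ≢_) xs
fresh xs p xs<p =
  let z , z∈p , z∉xs = smaller⇒misses p (fromList xs) (≤-<-trans (∣fromList∣≤length xs) xs<p)
  in z , z∈p , ∉fromList⁻ xs z∉xs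

unique⇒length≤ : ∀ {xs : List (Fin n)} {p} → Unique xs → All (_∈ p) xs → length xs ≤ ∣ p ∣
unique⇒length≤ [] [] = z≤n
unique⇒length≤ (x∉xs ∷ uniq) (x∈p ∷ xs∈p) = ≤-trans
  (s≤s (unique⇒length≤ uniq
    (All.zipWith (λ (x≢y , y∈p) → x∈p∧x≢y⇒x∈p-y y∈p (x≢y ∘ sym)) (x∉xs , xs∈p))))
  (x∈p⇒∣p-x∣<∣p∣ x∈p)

image : (Fin m → Fin n) → Subset m → Subset n
image f []            = ∅
image f (inside ∷ p)  = ⁅ f zero ⁆ ∪ image (f ∘ suc) p
image f (outside ∷ p) = image (f ∘ suc) p

∣image∣≤ : ∀ (f : Fin m → Fin n) p → ∣ image f p ∣ ≤ ∣ p ∣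
∣image∣≤ {n = n} f [] = ≤-reflexive (∣⊥∣≡0 n)
∣image∣≤ f (inside ∷ p)  =
  ≤-trans (∣⁅x⁆∪p∣≤1+∣p∣ (f zero) (image (f ∘ suc) p)) (s≤s (∣image∣≤ (f ∘ suc) p))
∣image∣≤ f (outside ∷ p) = ∣image∣≤ (f ∘ suc) p

∈-image : ∀ (f : Fin m → Fin n) {p v} → v ∈ p → f v ∈ image f p
∈-image f {inside ∷ p} hereᵛ = x∈p∪q⁺ (inj₁ (x∈⁅x⁆ _))
∈-image f {inside ∷ p} (thereᵛ v∈p) = x∈p∪q⁺ (inj₂ (∈-image (f ∘ suc) v∈p))
∈-image f {outside ∷ p} (thereᵛ v∈p) = ∈-image (f ∘ suc) v∈p

∈-allSubsets : ∀ (S : Subset n) → S ∈ˡ allSubsets n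
∈-allSubsets []            = here refl
∈-allSubsets (inside ∷ S)  = ∈-++⁺ˡ (∈-map⁺ (inside ∷_) (∈-allSubsets S))
∈-allSubsets (outside ∷ S) =
  ∈-++⁺ʳ (map (inside ∷_) (allSubsets _)) (∈-map⁺ (outside ∷_) (∈-allSubsets S))

-- Neighbourhoods, domination number and game value

module _ (G : Graph n) where

  Adj-sym : ∀ {u v} → Adj G u v → Adj G v u
  Adj-sym {u} {v} = subst T (adj-sym G u v)

  ∈N⁺ : ∀ {v w} → v ≡ w ⊎ Adj G v w → w ∈ N[ G ] v
  ∈N⁺ {v} {w} v≡w⊎vw = lookup⇒[]= w _ (trans (lookup∘tabulate _ w) (holds v≡w⊎vw))
    where
    holds : v ≡ w ⊎ Adj G v w → does (v ≟ w) ∨ adj G v w ≡ true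
    holds r with v ≟ w | r
    ... | yes _   | _        = refl
    ... | no  v≢w | inj₁ v≡w = contradiction v≡w v≢w
    ... | no  _   | inj₂ vw  = T⇒true vw

  ∈N⁻ : ∀ {v w} → w ∈ N[ G ] v → v ≡ w ⊎ Adj G v w
  ∈N⁻ {v} {w} w∈N with v ≟ w | trans (sym (lookup∘tabulate _ w)) ([]=⇒lookup w∈N)
  ... | yes v≡w | _  = inj₁ v≡w
  ... | no  _   | eq = inj₂ (Equivalence.from T-≡ eq)

  v∈N[v] : ∀ {v} → v ∈ N[ G ] v
  v∈N[v] = ∈N⁺ (inj₁ refl)

  neighbours : Fin n → Subset n
  neighbours v = tabulate (adj G v)

  ∈neighbours⁺ : ∀ {v w} → Adj G v w → w ∈ neighbours v
  ∈neighbours⁺ {v} {w} vw = lookup⇒[]= w _ (trans (lookup∘tabulate _ w) (T⇒true vw))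

  ∈neighbours⁻ : ∀ {v w} → w ∈ neighbours v → Adj G v w
  ∈neighbours⁻ {v} {w} w∈ =
    Equivalence.from T-≡ (trans (sym (lookup∘tabulate _ w)) ([]=⇒lookup w∈))

  γ≤∣dominating∣ : ∀ {S} → Dominating G S → γ G ≤ ∣ S ∣
  γ≤∣dominating∣ {S} dom =
    All.lookup (min≤xs n _) (∈-map⁺ ∣_∣ (∈-filter⁺ (dominating? G) (∈-allSubsets S) dom))

  minimum-dominating : ∃ λ S → Dominating G S × ∣ S ∣ ≡ γ G
  minimum-dominating with argmin-sel (λ c → c) n (map ∣_∣ (filter (dominating? G) (allSubsets n)))
  -- The default value `n` of the minimum is attained by the full vertex set.
  ... | inj₁ γ≡n = full , (λ v → v , ∈⊤ , v∈N[v]) , trans (∣⊤∣≡n n) (sym γ≡n)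
  ... | inj₂ γ∈  = 
    let S , S∈ , γ≡ = ∈-map⁻ ∣_∣ γ∈
    in S , proj₂ (∈-filter⁻ (dominating? G) {xs = allSubsets n} S∈) , sym γ≡

  Covers : Subset n → Subset n → Set
  Covers D S = ∀ {v} → v ∉ D → ∃ λ u → u ∈ S × v ∈ N[ G ] u

  -- Either no move is left or some legal move attains the value, whoever is to move; arguments
  -- valid for both players use only this.
  data Outcome (k : ℕ) (p : Player) (D : Subset n) : Set where
    over  : (∀ {v} → ¬ Legal G D v) → movesLeft (suc k) G p D ≡ 0 → Outcome k p D
    moved : ∀ {u} → Legal G D u →
      movesLeft (suc k) G p D ≡ suc (movesLeft k G (opponent p) (D ∪ N[ G ] u)) →
      Outcome k p D

  optimum-sel : ∀ p x xs → optimum p x xs ≡ x ⊎ optimum p x xs ∈ˡ xs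
  optimum-sel Dominator = argmin-sel (λ c → c)
  optimum-sel Staller   = argmax-sel (λ c → c)

  bestMove-attained : ∀ k p D v vs → ∃ λ u → u ∈ˡ v ∷ vs ×
    bestMove k G p D (v ∷ vs) ≡ suc (movesLeft k G (opponent p) (D ∪ N[ G ] u))
  bestMove-attained k p D v vs with optimum-sel p _ (map _ vs)
  ... | inj₁ eq = v , here refl , cong suc eq
  ... | inj₂ o∈ = let u , u∈vs , eq = ∈-map⁻ _ o∈ in u , there u∈vs , cong suc eq

  outcome : ∀ k p D → Outcome k p D
  outcome k p D = from-moves (legalMoves G D) refl
    where
    from-moves : ∀ vs → legalMoves G D ≡ vs → Outcome k p D
    from-moves [] eq =
      over (λ {v} lv → case-[] (subst (v ∈ˡ_) eq (∈-filter⁺ (legal? G D) (∈-allFin v) lv)))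
           (cong (bestMove k G p D) eq)
      where
      case-[] : ∀ {v : Fin n} → ¬ (v ∈ˡ [])
      case-[] ()
    from-moves (v ∷ vs) eq =
      let u , u∈ , best = bestMove-attained k p D v vs
      in moved (proj₂ (∈-filter⁻ (legal? G D) {xs = allFin n} (subst (u ∈ˡ_) (sym eq) u∈)))
               (trans (cong (bestMove k G p D) eq) best)

  Dominator-≤ : ∀ k {D u} → Legal G D u →
    movesLeft (suc k) G Dominator D ≤ suc (movesLeft k G Staller (D ∪ N[ G ] u))
  Dominator-≤ k {D} {u} lu with legalMoves G D | ∈-filter⁺ (legal? G D) (∈-allFin u) lu
  ... | v ∷ vs | here refl = s≤s (min≤⊤ _ (map _ vs))
  ... | v ∷ vs | there u∈  = s≤s (All.lookup (min≤xs _ (map _ vs)) (∈-map⁺ _ u∈))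

  Staller-≥ : ∀ k {D u} → Legal G D u →
    suc (movesLeft k G Dominator (D ∪ N[ G ] u)) ≤ movesLeft (suc k) G Staller D
  Staller-≥ k {D} {u} lu with legalMoves G D | ∈-filter⁺ (legal? G D) (∈-allFin u) lu
  ... | v ∷ vs | here refl = s≤s (⊥≤max _ (map _ vs))
  ... | v ∷ vs | there u∈  = s≤s (All.lookup (xs≤max _ (map _ vs)) (∈-map⁺ _ u∈))

  -- The moves of one line of optimal play form `S`. The bound on `∁ D` keeps the fuel from running
  -- out while a vertex is still undominated.
  movesLeft-covers : ∀ k p D → ∣ ∁ D ∣ ≤ k → ∃ λ S → Covers D S × ∣ S ∣ ≤ movesLeft k G p D
  movesLeft-covers zero p D ∁D≤0 =
    ∅ , (λ v∉D → contradiction ∁D≤0 (<⇒≱ (≤-<-trans z≤n (x∈p⇒∣p-x∣<∣p∣ (x∉p⇒x∈∁p v∉D))))) ,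
    ≤-reflexive (∣⊥∣≡0 n)
  movesLeft-covers (suc k) p D ∁D≤k with outcome k p D
  ... | over none eq =
    -- An undominated vertex would itself be a legal move.
    ∅ , (λ {v} v∉D → contradiction (v , v∈N[v] , v∉D) none) ,
    ≤-trans (≤-reflexive (∣⊥∣≡0 n)) z≤n
  ... | moved {u} (w , w∈N , w∉D) eq with movesLeft-covers k (opponent p) (D ∪ N[ G ] u) smaller
    where
    D⊂D∪N : D ⊂ (D ∪ N[ G ] u)
    D⊂D∪N = p⊆p∪q _ , w , x∈p∪q⁺ (inj₂ w∈N) , w∉D
    smaller : ∣ ∁ (D ∪ N[ G ] u) ∣ ≤ k
    smaller with s≤s le ← ≤-trans (p⊂q⇒∣p∣<∣q∣ (p⊂q⇒∁p⊃∁q D⊂D∪N)) ∁D≤k = le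
  ... | S , covers , S≤ =
    ⁅ u ⁆ ∪ S , covers′ , ≤-trans (∣⁅x⁆∪p∣≤1+∣p∣ u S) (≤-trans (s≤s S≤) (≤-reflexive (sym eq)))
    where
    covers′ : Covers D (⁅ u ⁆ ∪ S)
    covers′ {v} v∉D with v ∈? N[ G ] u
    ... | yes v∈N = u , x∈p∪q⁺ (inj₁ (x∈⁅x⁆ u)) , v∈N
    ... | no  v∉N =
      let t , t∈S , v∈Nt = covers (λ v∈ → case-∪ (x∈p∪q⁻ D _ v∈))
      in t , x∈p∪q⁺ (inj₂ t∈S) , v∈Nt
      where
      case-∪ : v ∈ D ⊎ v ∈ N[ G ] u → ⊥
      case-∪ (inj₁ v∈D) = v∉D v∈D
      case-∪ (inj₂ v∈N) = v∉N v∈N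

  γ≤γg : γ G ≤ γg G
  γ≤γg =
    let S , covers , S≤ = movesLeft-covers n Dominator ∅ (∣p∣≤n (∁ ∅))
    in ≤-trans (γ≤∣dominating∣ (λ v → covers ∉⊥)) S≤

-- Invariance under isomorphism

≅-sym : ∀ (G : Graph m) (H : Graph n) → G ≅ H → H ≅ G
≅-sym G H (π , iso) =
  flipₚ π , λ u v → sym (trans (iso _ _) (cong₂ (adj H) (inverseʳ π) (inverseʳ π)))

N-iso⁺ : ∀ (G : Graph m) (H : Graph n) ((π , _) : G ≅ H) {u v} →
  v ∈ N[ G ] u → (π ⟨$⟩ʳ v) ∈ N[ H ] (π ⟨$⟩ʳ u)
N-iso⁺ G H (π , iso) v∈N with ∈N⁻ G v∈N
... | inj₁ refl = v∈N[v] H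
... | inj₂ uv   = ∈N⁺ H (inj₂ (subst T (iso _ _) uv))

N-iso⁻ : ∀ (G : Graph m) (H : Graph n) ((π , _) : G ≅ H) {u v} →
  (π ⟨$⟩ʳ v) ∈ N[ H ] (π ⟨$⟩ʳ u) → v ∈ N[ G ] u
N-iso⁻ G H G≅H@(π , _) v∈N =
  subst₂ (λ a b → b ∈ N[ G ] a) (inverseˡ π) (inverseˡ π) (N-iso⁺ H G (≅-sym G H G≅H) v∈N)

Dominating-image : ∀ (G : Graph m) (H : Graph n) ((π , _) : G ≅ H) {S} →
  Dominating G S → Dominating H (image (π ⟨$⟩ʳ_) S)
Dominating-image G H G≅H@(π , _) dom v =
  let u , u∈S , v∈N = dom (π ⟨$⟩ˡ v)
  in π ⟨$⟩ʳ u , ∈-image _ u∈S , subst (_∈ N[ H ] (π ⟨$⟩ʳ u)) (inverseʳ π) (N-iso⁺ G H G≅H v∈N)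

γ-iso-≤ : ∀ (G : Graph m) (H : Graph n) → G ≅ H → γ H ≤ γ G
γ-iso-≤ G H G≅H@(π , _) =
  let S , dom , ∣S∣≡γ = minimum-dominating G
  in ≤-trans (γ≤∣dominating∣ H (Dominating-image G H G≅H dom))
             (≤-trans (∣image∣≤ (π ⟨$⟩ʳ_) S) (≤-reflexive ∣S∣≡γ))

γ-iso : ∀ (G : Graph m) (H : Graph n) → G ≅ H → γ G ≡ γ H
γ-iso G H G≅H = ≤-antisym (γ-iso-≤ H G (≅-sym G H G≅H)) (γ-iso-≤ G H G≅H)

module _ (G : Graph m) (H : Graph n) (G≅H : G ≅ H) where

  private
    π : Permutation m n
    π = proj₁ G≅H

  Corresponds : Subset m → Subset n → Set
  Corresponds D D′ = ∀ v → v ∈ D ⇔ (π ⟨$⟩ʳ v) ∈ D′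

  Corresponds-∪N : ∀ {D D′} u → Corresponds D D′ →
    Corresponds (D ∪ N[ G ] u) (D′ ∪ N[ H ] (π ⟨$⟩ʳ u))
  Corresponds-∪N {D} {D′} u D~D′ v = mk⇔
    (λ v∈ → x∈p∪q⁺ (Sum.map (to (D~D′ v)) (N-iso⁺ G H G≅H) (x∈p∪q⁻ D _ v∈)))
    (λ v∈ → x∈p∪q⁺ (Sum.map (from (D~D′ v)) (N-iso⁻ G H G≅H) (x∈p∪q⁻ D′ _ v∈)))
    where open Equivalence

  Legal-iso⁺ : ∀ {D D′ u} → Corresponds D D′ → Legal G D u → Legal H D′ (π ⟨$⟩ʳ u)
  Legal-iso⁺ D~D′ (w , w∈N , w∉D) =
    π ⟨$⟩ʳ w , N-iso⁺ G H G≅H w∈N , w∉D ∘ Equivalence.from (D~D′ w)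

  Legal-iso⁻ : ∀ {D D′ u} → Corresponds D D′ → Legal H D′ (π ⟨$⟩ʳ u) → Legal G D u
  Legal-iso⁻ {u = u} D~D′ (w , w∈N , w∉D′) =
    π ⟨$⟩ˡ w ,
    N-iso⁻ G H G≅H (subst (_∈ N[ H ] (π ⟨$⟩ʳ u)) (sym (inverseʳ π)) w∈N) ,
    λ w∈D → w∉D′ (subst (_∈ _) (inverseʳ π) (Equivalence.to (D~D′ _) w∈D))

  -- On Dominator's turn an optimal move in `H` is pulled back along `π`; on Staller's turn an
  -- optimal move in `G` is pushed forward.
  movesLeft-iso-≤ : ∀ k p {D D′} → Corresponds D D′ → movesLeft k G p D ≤ movesLeft k H p D′
  movesLeft-iso-≤ zero p D~D′ = z≤n
  movesLeft-iso-≤ (suc k) Dominator {D} {D′} D~D′ with outcome H k Dominator D′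
  ... | moved {u′} lu′ eq = subst (movesLeft (suc k) G Dominator D ≤_) (sym eq)
    (via (π ⟨$⟩ˡ u′) (inverseʳ π))
    where
    -- The preimage of `u′` becomes a variable `u`, so that matching on `refl` can replace `u′` by
    -- its expression in `u`.
    via : ∀ u → π ⟨$⟩ʳ u ≡ u′ →
      movesLeft (suc k) G Dominator D ≤ suc (movesLeft k H Staller (D′ ∪ N[ H ] u′))
    via u refl = ≤-trans (Dominator-≤ G k (Legal-iso⁻ D~D′ lu′))
                         (s≤s (movesLeft-iso-≤ k Staller (Corresponds-∪N u D~D′)))
  ... | over none _ with outcome G k Dominator D
  ...   | over _ eq    = ≤-trans (≤-reflexive eq) z≤n
  ...   | moved lu _ = contradiction (Legal-iso⁺ D~D′ lu) none
  movesLeft-iso-≤ (suc k) Staller {D} {D′} D~D′ with outcome G k Staller D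
  ... | over _ eq = ≤-trans (≤-reflexive eq) z≤n
  ... | moved {u} lu eq = ≤-trans (≤-reflexive eq)
    (≤-trans (s≤s (movesLeft-iso-≤ k Dominator (Corresponds-∪N u D~D′)))
             (Staller-≥ H k (Legal-iso⁺ D~D′ lu)))

  γg-iso-≤ : γg G ≤ γg H
  γg-iso-≤ = subst (λ k → γg G ≤ movesLeft k H Dominator ∅) (↔⇒≡ π)
    (movesLeft-iso-≤ m Dominator (λ v → mk⇔ (λ v∈ → contradiction v∈ ∉⊥) (λ v∈ → contradiction v∈ ∉⊥)))

γg-iso : ∀ (G : Graph m) (H : Graph n) → G ≅ H → γg G ≡ γg H
γg-iso G H G≅H = ≤-antisym (γg-iso-≤ G H G≅H) (γg-iso-≤ H G (≅-sym G H G≅H))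

-- Induced embeddings

infix 4 _⊑_ _⊑?_

_⊑_ : Graph m → Graph n → Set
_⊑_ {m} {n} H G =
  Σ[ ι ∈ Fin m ↣ Fin n ] (∀ i j → adj G (Injection.to ι i) (Injection.to ι j) ≡ adj H i j)

⊑-trans : ∀ (F : Graph k) (H : Graph m) (G : Graph n) → F ⊑ H → H ⊑ G → F ⊑ G
⊑-trans F H G (ι , F⊑H) (κ , H⊑G) = κ ↣-∘ ι , λ i j → trans (H⊑G _ _) (F⊑H i j)

induced-⊑ : ∀ (G : Graph n) (ι : Fin m ↣ Fin n) → induced G ι ⊑ G
induced-⊑ G ι = ι , λ _ _ → refl

⊑⇒≤ : ∀ (H : Graph m) (G : Graph n) → H ⊑ G → m ≤ n
⊑⇒≤ H G (ι , _) = injective⇒≤ (Injection.injective ι)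

≅⇒⊑ : ∀ (G : Graph m) (H : Graph n) → G ≅ H → G ⊑ H
≅⇒⊑ G H (π , iso) = ↔⇒↣ π , λ i j → sym (iso i j)

-- Maps are encoded as vectors so that `anyVec?` can search through all of them.
IsEmbedding : Graph m → Graph n → Vec (Fin n) m → Set
IsEmbedding H G vs =
  (∀ i j → lookup vs i ≡ lookup vs j → i ≡ j) ×
  (∀ i j → adj G (lookup vs i) (lookup vs j) ≡ adj H i j)

isEmbedding? : ∀ (H : Graph m) (G : Graph n) vs → Dec (IsEmbedding H G vs)
isEmbedding? H G vs =
  (all? λ i → all? λ j → (lookup vs i ≟ lookup vs j) →-dec (i ≟ j)) ×-dec
  (all? λ i → all? λ j → adj G (lookup vs i) (lookup vs j) ≟ᵇ adj H i j)

embedding : ∀ (H : Graph m) (G : Graph n) vs → IsEmbedding H G vs → H ⊑ G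
embedding H G vs (inj , agree) = mk↣ {to = lookup vs} (inj _ _) , agree

anyVec? : ∀ {P : Vec (Fin n) m → Set} → (∀ vs → Dec (P vs)) → Dec (∃ P)
anyVec? {m = zero}  P? = map′ ([] ,_) (λ { ([] , p) → p }) (P? [])
anyVec? {m = suc m} P? =
  map′ (λ (v , vs , p) → v ∷ vs , p) (λ { (v ∷ vs , p) → v , vs , p })
    (any? λ v → anyVec? λ vs → P? (v ∷ vs))

_⊑?_ : ∀ (H : Graph m) (G : Graph n) → Dec (H ⊑ G)
H ⊑? G = map′ (λ (vs , e) → embedding H G vs e) tabulated (anyVec? (isEmbedding? H G))
  where
  tabulated : H ⊑ G → ∃ (IsEmbedding H G)
  tabulated (ι , agree) = tabulate to ,
    (λ i j eq → Injection.injective ι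
      (trans (sym (lookup∘tabulate to i)) (trans eq (lookup∘tabulate to j)))) ,
    (λ i j → trans (cong₂ (adj G) (lookup∘tabulate to i) (lookup∘tabulate to j)) (agree i j))
    where open Injection ι using (to)

-- Containing one of the eight obstructions

Obstructed : Graph n → Set
Obstructed G = path 5 ⊑ G ⊎ cycle 5 ⊑ G ⊎ ∃ λ i → ℱ i ⊑ G

obstructed? : (G : Graph n) → Dec (Obstructed G)
obstructed? G = (path 5 ⊑? G) ⊎-dec ((cycle 5 ⊑? G) ⊎-dec any? λ i → ℱ i ⊑? G)

Obstructed-⊑ : ∀ (H : Graph m) (G : Graph n) → H ⊑ G → Obstructed H → Obstructed G
Obstructed-⊑ H G H⊑G = Sum.map (λ p → ⊑-trans (path 5) H G p H⊑G)
  (Sum.map (λ c → ⊑-trans (cycle 5) H G c H⊑G) (λ (i , f) → i , ⊑-trans (ℱ i) H G f H⊑G))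

TriangleFree-⊑ : ∀ (H : Graph m) (G : Graph n) → H ⊑ G → TriangleFree G → TriangleFree H
TriangleFree-⊑ H G (ι , agree) tf u v w (uv , vw , uw) =
  tf _ _ _ (back uv , back vw , back uw)
  where
  back : ∀ {i j} → Adj H i j → Adj G (Injection.to ι i) (Injection.to ι j)
  back {i} {j} = subst T (sym (agree i j))

_<ᵇᶠ_ : Fin n → Fin n → Bool
i <ᵇᶠ j = toℕ i <ᵇ toℕ j

Twins : Graph n → Fin n → Fin n → Set
Twins H i j = ∀ l → adj H i l ≡ adj H j l

-- Only an upper bound: `ps` may also list pairs that are not twins, which lets `sides` serve all
-- sixteen `doublyCentred` graphs.
TwinsAmong : Graph n → List (Fin n × Fin n) → Set
TwinsAmong H ps = ∀ i j → T (i <ᵇᶠ j) → Twins H i j → (i , j) ∈ˡ ps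

twinsAmong? : ∀ (H : Graph n) ps → Dec (TwinsAmong H ps)
twinsAmong? H ps = all? λ i → all? λ j → T? (i <ᵇᶠ j) →-dec
  ((all? λ l → adj H i l ≟ᵇ adj H j l) →-dec mem? (≡-dec _≟_ _≟_) (i , j) ps)

-- Vertices identified by an adjacency-preserving map are twins, so only twins need to be separated.
embedding-upTo-twins : ∀ (H : Graph m) (G : Graph n) (f : Fin m → Fin n) {ps} →
  TwinsAmong H ps → All (λ (i , j) → f i ≢ f j) ps →
  (∀ i j → T (i <ᵇᶠ j) → adj G (f i) (f j) ≡ adj H i j) → H ⊑ G
embedding-upTo-twins H G f twins apart upper = mk↣ (inj _ _) , agree
  where
  agree : ∀ i j → adj G (f i) (f j) ≡ adj H i j
  agree i j with <-cmp i j
  ... | tri< i<j _ _  = upper i j (<⇒<ᵇ i<j)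
  ... | tri≈ _ refl _ = trans (adj-irrefl G _) (sym (adj-irrefl H _))
  ... | tri> _ _ j<i  = trans (adj-sym G _ _) (trans (upper j i (<⇒<ᵇ j<i)) (adj-sym H j i))
  twins-of : ∀ i j → f i ≡ f j → Twins H i j
  twins-of i j eq l = trans (sym (agree i l)) (trans (cong (λ v → adj G v (f l)) eq) (agree j l))
  inj : ∀ i j → f i ≡ f j → i ≡ j
  inj i j eq with <-cmp i j
  ... | tri< i<j _ _ = contradiction eq (All.lookup apart (twins i j (<⇒<ᵇ i<j) (twins-of i j eq)))
  ... | tri≈ _ i≡j _ = i≡j
  ... | tri> _ _ j<i =
    contradiction (sym eq) (All.lookup apart (twins j i (<⇒<ᵇ j<i) (twins-of j i (sym eq))))

-- Finite checks on the concrete graphs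

path₅-twins : TwinsAmong (path 5) []
path₅-twins = from-yes (twinsAmong? (path 5) [])

cycle₅-twins : TwinsAmong (cycle 5) []
cycle₅-twins = from-yes (twinsAmong? (cycle 5) [])

F₁-twins : TwinsAmong F₁ ((0F , 2F) ∷ (3F , 5F) ∷ [])
F₁-twins = from-yes (twinsAmong? F₁ ((0F , 2F) ∷ (3F , 5F) ∷ []))

-- The bipartite graphs with parts {0, 1, 2} and {3, 4, 5} in which 0 and 3 see the whole opposite
-- part: each is one of F₂, …, F₆, or contains P₅.
doublyCentred : (p q r s : Bool) → Graph 6
doublyCentred p q r s = symmetrise edge
  where
  edge : Fin 6 → Fin 6 → Bool
  edge 0F 3F = true
  edge 0F 4F = true
  edge 0F 5F = true
  edge 1F 3F = true
  edge 2F 3F = true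
  edge 1F 4F = p
  edge 1F 5F = q
  edge 2F 4F = r
  edge 2F 5F = s
  edge _  _  = false

-- All pairs within a part. Twins lie in the same part because a `doublyCentred` graph is connected
-- and bipartite.
sides : List (Fin 6 × Fin 6)
sides = (0F , 1F) ∷ (0F , 2F) ∷ (1F , 2F) ∷ (3F , 4F) ∷ (3F , 5F) ∷ (4F , 5F) ∷ []

∀Bool? : ∀ {P : Bool → Set} → (∀ b → Dec (P b)) → Dec (∀ b → P b)
∀Bool? P? = map′ (λ { (pt , pf) true → pt ; (pt , pf) false → pf }) (λ p → p true , p false)
  (P? true ×-dec P? false)

doublyCentred-twins : ∀ p q r s → TwinsAmong (doublyCentred p q r s) sides
doublyCentred-twins = from-yes (∀Bool? λ p → ∀Bool? λ q → ∀Bool? λ r → ∀Bool? λ s →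
  twinsAmong? (doublyCentred p q r s) sides)

-- The result depends on the optional edges present: none gives F₂, one F₃, two with a common end
-- F₄, two disjoint ones P₅ (the `inj₁` cases), three F₅, four F₆.
candidate : (p q r s : Bool) → Vec (Fin 6) 5 ⊎ (Fin 6 × Vec (Fin 6) 6)
candidate true  true  true  true  = inj₂ (5F , 0F ∷ 1F ∷ 2F ∷ 3F ∷ 4F ∷ 5F ∷ [])
candidate true  true  true  false = inj₂ (4F , 0F ∷ 1F ∷ 2F ∷ 3F ∷ 4F ∷ 5F ∷ [])
candidate true  true  false true  = inj₂ (4F , 0F ∷ 1F ∷ 2F ∷ 3F ∷ 5F ∷ 4F ∷ [])
candidate true  true  false false = inj₂ (3F , 0F ∷ 1F ∷ 3F ∷ 4F ∷ 5F ∷ 2F ∷ [])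
candidate true  false true  true  = inj₂ (4F , 0F ∷ 2F ∷ 1F ∷ 3F ∷ 4F ∷ 5F ∷ [])
candidate true  false true  false = inj₂ (3F , 3F ∷ 4F ∷ 0F ∷ 1F ∷ 2F ∷ 5F ∷ [])
candidate true  false false true  = inj₁ (1F ∷ 4F ∷ 0F ∷ 5F ∷ 2F ∷ [])
candidate true  false false false = inj₂ (2F , 0F ∷ 3F ∷ 1F ∷ 4F ∷ 5F ∷ 2F ∷ [])
candidate false true  true  true  = inj₂ (4F , 0F ∷ 2F ∷ 1F ∷ 3F ∷ 5F ∷ 4F ∷ [])
candidate false true  true  false = inj₁ (1F ∷ 5F ∷ 0F ∷ 4F ∷ 2F ∷ [])
candidate false true  false true  = inj₂ (3F , 3F ∷ 5F ∷ 0F ∷ 1F ∷ 2F ∷ 4F ∷ [])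
candidate false true  false false = inj₂ (2F , 0F ∷ 3F ∷ 1F ∷ 5F ∷ 4F ∷ 2F ∷ [])
candidate false false true  true  = inj₂ (3F , 0F ∷ 2F ∷ 3F ∷ 4F ∷ 5F ∷ 1F ∷ [])
candidate false false true  false = inj₂ (2F , 0F ∷ 3F ∷ 2F ∷ 4F ∷ 5F ∷ 1F ∷ [])
candidate false false false true  = inj₂ (2F , 0F ∷ 3F ∷ 2F ∷ 5F ∷ 4F ∷ 1F ∷ [])
candidate false false false false = inj₂ (1F , 0F ∷ 3F ∷ 4F ∷ 5F ∷ 1F ∷ 2F ∷ [])

Realised : Graph 6 → Vec (Fin 6) 5 ⊎ (Fin 6 × Vec (Fin 6) 6) → Set
Realised K (inj₁ vs)       = IsEmbedding (path 5) K vs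
Realised K (inj₂ (i , vs)) = IsEmbedding (ℱ i) K vs

realised? : ∀ K c → Dec (Realised K c)
realised? K (inj₁ vs)       = isEmbedding? (path 5) K vs
realised? K (inj₂ (i , vs)) = isEmbedding? (ℱ i) K vs

realised⇒obstructed : ∀ K c → Realised K c → Obstructed K
realised⇒obstructed K (inj₁ vs)       e = inj₁ (embedding (path 5) K vs e)
realised⇒obstructed K (inj₂ (i , vs)) e = inj₂ (inj₂ (i , embedding (ℱ i) K vs e))

candidate-realised : ∀ p q r s → Realised (doublyCentred p q r s) (candidate p q r s)
candidate-realised = from-yes (∀Bool? λ p → ∀Bool? λ q → ∀Bool? λ r → ∀Bool? λ s →
  realised? (doublyCentred p q r s) (candidate p q r s))

doublyCentred-obstructed : ∀ p q r s → Obstructed (doublyCentred p q r s)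
doublyCentred-obstructed p q r s = realised⇒obstructed _ _ (candidate-realised p q r s)

-- Triangle-free graphs without the eight obstructions

module _ (G : Graph n) (triangle-free : TriangleFree G) (unobstructed : ¬ Obstructed G) where

  private
    infix 4 _~_

    _~_ : Fin n → Fin n → Set
    u ~ v = Adj G u v

    ~-sym : ∀ {u v} → u ~ v → v ~ u
    ~-sym = Adj-sym G

    common⇒≁ : ∀ {u v w} → v ~ u → v ~ w → ¬ u ~ w
    common⇒≁ vu vw uw = triangle-free _ _ _ (vu , uw , vw)

    adjacent : ∀ {u v} → u ~ v → adj G u v ≡ true
    adjacent = T⇒true

    nonadjacent : ∀ {u v} → ¬ u ~ v → adj G u v ≡ false
    nonadjacent = ¬T⇒false

  -- Depending on whether a ~ e, the five vertices induce C₅ or P₅.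
  no-walk : ∀ {a b c d e} → a ~ b → b ~ c → c ~ d → d ~ e → ¬ a ~ d → ¬ b ~ e → ⊥
  no-walk {a} {b} {c} {d} {e} ab bc cd de a≁d b≁e with T? (adj G a e)
  ... | yes ae = unobstructed (inj₂ (inj₁ (embedding-upTo-twins (cycle 5) G
    (lookup (a ∷ b ∷ c ∷ d ∷ e ∷ [])) cycle₅-twins [] λ where
      0F 1F _ → adjacent ab
      0F 2F _ → nonadjacent (common⇒≁ (~-sym ab) bc)
      0F 3F _ → nonadjacent a≁d
      0F 4F _ → adjacent ae
      1F 2F _ → adjacent bc
      1F 3F _ → nonadjacent (common⇒≁ (~-sym bc) cd)
      1F 4F _ → nonadjacent b≁e
      2F 3F _ → adjacent cd
      2F 4F _ → nonadjacent (common⇒≁ (~-sym cd) de)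
      3F 4F _ → adjacent de)))
  ... | no a≁e = unobstructed (inj₁ (embedding-upTo-twins (path 5) G
    (lookup (a ∷ b ∷ c ∷ d ∷ e ∷ [])) path₅-twins [] λ where
      0F 1F _ → adjacent ab
      0F 2F _ → nonadjacent (common⇒≁ (~-sym ab) bc)
      0F 3F _ → nonadjacent a≁d
      0F 4F _ → nonadjacent a≁e
      1F 2F _ → adjacent bc
      1F 3F _ → nonadjacent (common⇒≁ (~-sym bc) cd)
      1F 4F _ → nonadjacent b≁e
      2F 3F _ → adjacent cd
      2F 4F _ → nonadjacent (common⇒≁ (~-sym cd) de)
      3F 4F _ → adjacent de))

  -- The twins of `F₁` are the two ends of each path, which accounts for `a ≢ c` and `d ≢ f`;
  -- triangle-freeness makes these ends nonadjacent.
  no-2P₃ : ∀ {a b c d e f} → a ~ b → b ~ c → d ~ e → e ~ f → a ≢ c → d ≢ f →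
    (∀ {u v} → u ∈ˡ a ∷ b ∷ c ∷ [] → v ∈ˡ d ∷ e ∷ f ∷ [] → ¬ u ~ v) → ⊥
  no-2P₃ {a} {b} {c} {d} {e} {f} ab bc de ef a≢c d≢f apart =
    unobstructed (inj₂ (inj₂ (0F , embedding-upTo-twins F₁ G
      (lookup (a ∷ b ∷ c ∷ d ∷ e ∷ f ∷ [])) F₁-twins (a≢c ∷ d≢f ∷ []) λ where
        0F 1F _ → adjacent ab
        0F 2F _ → nonadjacent (common⇒≁ (~-sym ab) bc)
        0F 3F _ → nonadjacent (apart first first)
        0F 4F _ → nonadjacent (apart first second)
        0F 5F _ → nonadjacent (apart first third)
        1F 2F _ → adjacent bc
        1F 3F _ → nonadjacent (apart second first)
        1F 4F _ → nonadjacent (apart second second)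
        1F 5F _ → nonadjacent (apart second third)
        2F 3F _ → nonadjacent (apart third first)
        2F 4F _ → nonadjacent (apart third second)
        2F 5F _ → nonadjacent (apart third third)
        3F 4F _ → adjacent de
        3F 5F _ → nonadjacent (common⇒≁ (~-sym de) ef)
        4F 5F _ → adjacent ef)))
    where
    first : ∀ {x y z : Fin n} → x ∈ˡ x ∷ y ∷ z ∷ []
    first = here refl
    second : ∀ {x y z : Fin n} → y ∈ˡ x ∷ y ∷ z ∷ []
    second = there (here refl)
    third : ∀ {x y z : Fin n} → z ∈ˡ x ∷ y ∷ z ∷ []
    third = there (there (here refl))

  -- Triangle-freeness makes both parts independent. The edges between `a′`, `a″` and `b′`, `b″` are
  -- left open, since every choice of them is obstructed.
  no-doublyCentred : ∀ {a a′ a″ b b′ b″} → a ~ b → a ~ b′ → a ~ b″ → b ~ a′ → b ~ a″ →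
    a ≢ a′ → a ≢ a″ → a′ ≢ a″ → b ≢ b′ → b ≢ b″ → b′ ≢ b″ → ⊥
  no-doublyCentred {a} {a′} {a″} {b} {b′} {b″} ab ab′ ab″ ba′ ba″ a≢a′ a≢a″ a′≢a″ b≢b′ b≢b″ b′≢b″ =
    unobstructed (Obstructed-⊑ K G
      (embedding-upTo-twins K G (lookup (a ∷ a′ ∷ a″ ∷ b ∷ b′ ∷ b″ ∷ []))
        (doublyCentred-twins _ _ _ _)
        (a≢a′ ∷ a≢a″ ∷ a′≢a″ ∷ b≢b′ ∷ b≢b″ ∷ b′≢b″ ∷ []) λ where
          0F 1F _ → nonadjacent (common⇒≁ (~-sym ab) ba′)
          0F 2F _ → nonadjacent (common⇒≁ (~-sym ab) ba″)
          0F 3F _ → adjacent ab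
          0F 4F _ → adjacent ab′
          0F 5F _ → adjacent ab″
          1F 2F _ → nonadjacent (common⇒≁ ba′ ba″)
          1F 3F _ → adjacent (~-sym ba′)
          -- An optional edge is listed in one direction only, so symmetrising yields `_ ∨ false`.
          1F 4F _ → sym (∨-identityʳ _)
          1F 5F _ → sym (∨-identityʳ _)
          2F 3F _ → adjacent (~-sym ba″)
          2F 4F _ → sym (∨-identityʳ _)
          2F 5F _ → sym (∨-identityʳ _)
          3F 4F _ → nonadjacent (common⇒≁ ab ab′)
          3F 5F _ → nonadjacent (common⇒≁ ab ab″)
          4F 5F _ → nonadjacent (common⇒≁ ab′ ab″))
      (doublyCentred-obstructed _ _ _ _))
    where
    K : Graph 6
    K = doublyCentred (adj G a′ b′) (adj G a′ b″) (adj G a″ b′) (adj G a″ b″)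

  -- Vertices outside the closed neighbourhood of a vertex of maximum degree

  module MaximumDegree (x : Fin n) (maximum : ∀ v → ∣ neighbours G v ∣ ≤ ∣ neighbours G x ∣) where

    Far : Fin n → Set
    Far w = w ∉ N[ G ] x

    far⇒≁ : ∀ {w} → Far w → ¬ x ~ w
    far⇒≁ far xw = far (∈N⁺ G (inj₂ xw))

    far⇒≢ : ∀ {w} → Far w → x ≢ w
    far⇒≢ far x≡w = far (∈N⁺ G (inj₁ x≡w))

    -- By maximality `x` has at least as many neighbours as `v`, hence at least `length us`, and the
    -- shorter list `ys` cannot exhaust them.
    other-neighbour : ∀ {v} ys {us} → Unique us → All (v ~_) us → length ys < length us →
      ∃ λ z → x ~ z × All (z ≢_) ys
    other-neighbour {v} ys uniq v~us ys<us =
      let z , z∈ , z∉ys = fresh ys (neighbours G x)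
            (<-≤-trans ys<us (≤-trans (unique⇒length≤ uniq (All.map (∈neighbours⁺ G) v~us)) (maximum v)))
      in z , ∈neighbours⁻ G z∈ , z∉ys

    -- Otherwise N(x) would be a proper subset of N(w), with `u` in the difference, against
    -- maximality.
    private-neighbour : ∀ {w u} → w ~ u → ¬ x ~ u → ∃ λ z → x ~ z × ¬ w ~ z
    private-neighbour {w} {u} wu x≁u
      with any? (λ z → T? (adj G x z) ×-dec ¬? (T? (adj G w z)))
    ... | yes z  = z
    ... | no  ¬z = contradiction (maximum w) (<⇒≱ (p⊂q⇒∣p∣<∣q∣ Nx⊂Nw))
      where
      Nx⊂Nw : neighbours G x ⊂ neighbours G w
      Nx⊂Nw =
        (λ {z} z∈ → ∈neighbours⁺ G (decidable-stable (T? (adj G w z))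
          λ w≁z → ¬z (z , ∈neighbours⁻ G z∈ , w≁z))) ,
        u , ∈neighbours⁺ G wu , x≁u ∘ ∈neighbours⁻ G

    -- For a neighbour `z` of `x` not adjacent to `w`, the walk z, x, b, w, u is excluded by
    -- `no-walk`.
    far-edge-isolated : ∀ {w u b} → Far w → Far u → w ~ u → x ~ b → ¬ b ~ w
    far-edge-isolated far-w far-u wu xb bw =
      let z , xz , w≁z = private-neighbour wu (far⇒≁ far-u)
      in no-walk (~-sym xz) xb bw wu (w≁z ∘ ~-sym) (far⇒≁ far-u)

    -- Two neighbours of `w` give a path u, w, v. By maximality `x` also has two neighbours, giving
    -- b, x, b′, and `far-edge-isolated` rules out edges between the paths: an induced 2P₃.
    far-edge-unique : ∀ {w u v} → Far w → Far u → w ~ u → w ~ v → v ≡ u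
    far-edge-unique {w} {u} {v} far-w far-u wu wv with v ≟ u
    ... | yes v≡u = v≡u
    ... | no  v≢u =
      let b  , xb  , _             = other-neighbour [] distinct both (s≤s z≤n)
          b′ , xb′ , b′≢b   = other-neighbour (b ∷ []) distinct both (s≤s (s≤s z≤n))
      in ⊥-elim (no-2P₃ (~-sym xb) xb′ (~-sym wu) wv (All.head b′≢b ∘ sym) (v≢u ∘ sym) λ where
           (here refl) (here refl)                         → far-edge-isolated far-u far-w (~-sym wu) xb
           (here refl) (there (here refl))                 → far-edge-isolated far-w far-u wu xb
           (here refl) (there (there (here refl)))         → far-edge-isolated far-v far-w (~-sym wv) xb
           (there (here refl)) (here refl)                 → far⇒≁ far-u
           (there (here refl)) (there (here refl))         → far⇒≁ far-w
           (there (here refl)) (there (there (here refl))) → far⇒≁ far-v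
           (there (there (here refl))) (here refl)         → far-edge-isolated far-u far-w (~-sym wu) xb′
           (there (there (here refl))) (there (here refl)) → far-edge-isolated far-w far-u wu xb′
           (there (there (here refl))) (there (there (here refl))) →
             far-edge-isolated far-v far-w (~-sym wv) xb′)
      where
      distinct : Unique (u ∷ v ∷ [])
      distinct = ((v≢u ∘ sym) ∷ []) ∷ [] ∷ []
      both : All (w ~_) (u ∷ v ∷ [])
      both = wu ∷ wv ∷ []
      -- A neighbour of `x` adjacent to `w` would contradict the isolation of the edge from `w` to
      -- `u`.
      far-v : Far v
      far-v v∈N with ∈N⁻ G v∈N
      ... | inj₁ refl = far⇒≁ far-w (~-sym wv)
      ... | inj₂ xv   = far-edge-isolated far-w far-u wu xv (~-sym wv)

    -- If `w` and `w′` differ, `b` has degree at least three, so by maximality `x` has two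
    -- neighbours besides `b`; then `x` and `b` are the centres of a `doublyCentred` graph.
    common-neighbour-unique : ∀ {w w′ b} → Far w → Far w′ → x ~ b → b ~ w → b ~ w′ → w ≡ w′
    common-neighbour-unique {w} {w′} {b} far-w far-w′ xb bw bw′ with w ≟ w′
    ... | yes w≡w′ = w≡w′
    ... | no  w≢w′ =
      let distinct = (far⇒≢ far-w ∷ far⇒≢ far-w′ ∷ []) ∷ (w≢w′ ∷ []) ∷ [] ∷ []
          b~       = ~-sym xb ∷ bw ∷ bw′ ∷ []
          y , xy , y≢ = other-neighbour (b ∷ []) distinct b~ (s≤s (s≤s z≤n))
          z , xz , z≢ = other-neighbour (b ∷ y ∷ []) distinct b~ ≤-refl
      in ⊥-elim (no-doublyCentred xb xy xz bw bw′ (far⇒≢ far-w) (far⇒≢ far-w′) w≢w′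
           (All.head y≢ ∘ sym) (All.head z≢ ∘ sym) (All.head (All.tail z≢) ∘ sym))

    -- Unless `b` or `b′` sees both far vertices, the walk w, b, x, b′, w′ is excluded by `no-walk`.
    distance-two-unique : ∀ {w w′ b b′} → Far w → Far w′ →
      x ~ b → b ~ w → x ~ b′ → b′ ~ w′ → w ≡ w′
    distance-two-unique {w} {w′} {b} {b′} far-w far-w′ xb bw xb′ b′w′
      with T? (adj G b w′) | T? (adj G b′ w)
    ... | yes bw′ | _       = common-neighbour-unique far-w far-w′ xb bw bw′
    ... | no  _   | yes b′w = common-neighbour-unique far-w far-w′ xb′ b′w b′w′
    ... | no b≁w′ | no b′≁w =
      ⊥-elim (no-walk (~-sym bw) (~-sym xb) xb′ b′w′ (b′≁w ∘ ~-sym) b≁w′)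

    -- The pointwise form of "equal or disjoint" for closed neighbourhoods restricted to far
    -- vertices. For `u` in N[x] the restriction has at most one vertex; a far `u` has at most one
    -- far neighbour.
    traces-equal : ∀ {u v w w′} → Far w → Far w′ →
      w ∈ N[ G ] u → w ∈ N[ G ] v → w′ ∈ N[ G ] u → w′ ∈ N[ G ] v
    traces-equal {u} {v} {w} {w′} far-w far-w′ w∈Nu w∈Nv w′∈Nu with u ∈? N[ G ] x
    ... | yes u∈Nx = subst (_∈ N[ G ] v) w≡w′ w∈Nv
      where
      w≡w′ : w ≡ w′
      w≡w′ with ∈N⁻ G u∈Nx | ∈N⁻ G w∈Nu | ∈N⁻ G w′∈Nu
      ... | inj₁ refl | _         | _         = contradiction w∈Nu far-w
      ... | inj₂ xu   | inj₁ refl | _         = contradiction u∈Nx far-w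
      ... | inj₂ xu   | inj₂ _    | inj₁ refl = contradiction u∈Nx far-w′
      ... | inj₂ xu   | inj₂ uw   | inj₂ uw′  = common-neighbour-unique far-w far-w′ xu uw uw′
    ... | no far-u with ∈N⁻ G w∈Nu | ∈N⁻ G w′∈Nu | ∈N⁻ G w∈Nv
    ...   | inj₁ refl | inj₁ refl | _         = w∈Nv
    ...   | inj₁ refl | inj₂ ww′  | inj₁ refl = w′∈Nu
    ...   | inj₁ refl | inj₂ ww′  | inj₂ vw   =
      ∈N⁺ G (inj₁ (far-edge-unique far-w far-w′ ww′ (~-sym vw)))
    ...   | inj₂ uw   | inj₁ refl | inj₁ refl = ∈N⁺ G (inj₂ (~-sym uw))
    ...   | inj₂ uw   | inj₁ refl | inj₂ vw   =
      ∈N⁺ G (inj₁ (far-edge-unique far-w far-u (~-sym uw) (~-sym vw)))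
    ...   | inj₂ uw   | inj₂ uw′  | _         =
      subst (_∈ N[ G ] v) (sym (far-edge-unique far-u far-w uw uw′)) w∈Nv

    -- Whichever player moves, each move lets one vertex be dropped from the cover.
    movesLeft≤∣cover∣ : ∀ k p D {S} → N[ G ] x ⊆ D → Covers G D S → movesLeft k G p D ≤ ∣ S ∣
    movesLeft≤∣cover∣ zero    p D Nx⊆D covers = z≤n
    movesLeft≤∣cover∣ (suc k) p D {S} Nx⊆D covers with outcome G k p D
    ... | over _ eq = ≤-trans (≤-reflexive eq) z≤n
    ... | moved {u} (w , w∈Nu , w∉D) eq =
      let s , s∈S , w∈Ns = covers w∉D
      in ≤-trans (≤-reflexive eq)
           (≤-trans (s≤s (movesLeft≤∣cover∣ k (opponent p) (D ∪ N[ G ] u)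
                            (p⊆p∪q _ ∘ Nx⊆D) (remaining s w∈Ns)))
                    (x∈p⇒∣p-x∣<∣p∣ s∈S))
      where
      -- The move `u` and the cover vertex `s` share the far vertex `w`, so by `traces-equal` the
      -- move dominates every far vertex that `s` dominates.
      remaining : ∀ s → w ∈ N[ G ] s → Covers G (D ∪ N[ G ] u) (S - s)
      remaining s w∈Ns {v} v∉D∪Nu =
        let v∉D = v∉D∪Nu ∘ x∈p∪q⁺ ∘ inj₁
            t , t∈S , v∈Nt = covers v∉D
        in t , x∈p∧x≢y⇒x∈p-y t∈S (λ { refl → v∉D∪Nu (x∈p∪q⁺ (inj₂
                 (traces-equal (w∉D ∘ Nx⊆D) (v∉D ∘ Nx⊆D) w∈Ns w∈Nu v∈Nt))) }) , v∈Nt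

    -- The strict decrease pays for Dominator's opening move at `x`.
    remove-redundant : ∀ {S s} → Dominating G S → s ∈ S →
      (∀ {v} → Far v → v ∈ N[ G ] s → ∃ λ t → t ∈ S × t ≢ s × v ∈ N[ G ] t) →
      ∃ λ S′ → Covers G (N[ G ] x) S′ × ∣ S′ ∣ < ∣ S ∣
    remove-redundant {S} {s} dom s∈S redundant = S - s , covers , x∈p⇒∣p-x∣<∣p∣ s∈S
      where
      covers : Covers G (N[ G ] x) (S - s)
      covers {v} far with dom v
      ... | t , t∈S , v∈Nt with t ≟ s
      ...   | no  t≢s  = t , x∈p∧x≢y⇒x∈p-y t∈S t≢s , v∈Nt
      ...   | yes refl =
        let t′ , t′∈S , t′≢s , v∈Nt′ = redundant far v∈Nt
        in t′ , x∈p∧x≢y⇒x∈p-y t′∈S t′≢s , v∈Nt′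

    -- If the vertex b of S that dominates x is not redundant itself, it sees a vertex w at distance
    -- two from x; the vertex of S that dominates a further neighbour b′ of x is then redundant,
    -- since w is the only vertex at distance two from x.
    smaller-cover : ∀ {S} → Dominating G S → ∃ λ S′ → Covers G (N[ G ] x) S′ × ∣ S′ ∣ < ∣ S ∣
    smaller-cover {S} dom with dom x
    ... | b , b∈S , x∈Nb with any? (λ w → ¬? (w ∈? N[ G ] x) ×-dec (w ∈? N[ G ] b))
    ...   | no  none = remove-redundant dom b∈S λ far v∈Nb → contradiction (_ , far , v∈Nb) none
    ...   | yes (w , far-w , w∈Nb) with ∈N⁻ G x∈Nb | ∈N⁻ G w∈Nb
    ...     | inj₁ refl | _         = contradiction w∈Nb far-w
    ...     | inj₂ bx   | inj₁ refl = contradiction (~-sym bx) (far⇒≁ far-w)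
    ...     | inj₂ bx   | inj₂ bw   =
      let b′ , xb′ , b′≢b = other-neighbour (b ∷ [])
            ((far⇒≢ far-w ∷ []) ∷ [] ∷ []) (bx ∷ bw ∷ []) (s≤s (s≤s z≤n))
          s , s∈S , b′∈Ns = dom b′
      in remove-redundant dom s∈S λ far-v v∈Ns →
           b , b∈S , (λ b≡s → b′∉Nb xb′ (All.head b′≢b) (subst (λ t → b′ ∈ N[ G ] t) (sym b≡s) b′∈Ns)) ,
           subst (_∈ N[ G ] b) (only-w xb′ b′∈Ns far-v v∈Ns) w∈Nb
      where
      b′∉Nb : ∀ {b′} → x ~ b′ → b′ ≢ b → b′ ∉ N[ G ] b
      b′∉Nb xb′ b′≢b b′∈Nb with ∈N⁻ G b′∈Nb
      ... | inj₁ b≡b′ = b′≢b (sym b≡b′)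
      ... | inj₂ bb′  = common⇒≁ (~-sym bx) xb′ bb′
      -- Either `s` is `b′`, or `s` is far and equals `v` by `far-edge-isolated`; both put `v` at
      -- distance two from `x`. If `s` is `x`, it dominates no far vertex, and if `s` lies in N(x),
      -- it forms a triangle with `x` and `b′`.
      only-w : ∀ {b′ s v} → x ~ b′ → b′ ∈ N[ G ] s → Far v → v ∈ N[ G ] s → w ≡ v
      only-w {s = s} xb′ b′∈Ns far-v v∈Ns with s ∈? N[ G ] x | ∈N⁻ G b′∈Ns | ∈N⁻ G v∈Ns
      ... | _ | inj₁ refl | inj₁ refl = contradiction xb′ (far⇒≁ far-v)
      ... | _ | inj₁ refl | inj₂ b′v  = distance-two-unique far-w far-v (~-sym bx) bw xb′ b′v
      ... | no far-s | inj₂ sb′ | inj₁ refl =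
        distance-two-unique far-w far-v (~-sym bx) bw xb′ (~-sym sb′)
      ... | no far-s | inj₂ sb′ | inj₂ sv =
        contradiction (~-sym sb′) (far-edge-isolated far-s far-v sv xb′)
      ... | yes s∈Nx | inj₂ sb′ | _ with ∈N⁻ G s∈Nx
      ...   | inj₁ refl = contradiction v∈Ns far-v
      ...   | inj₂ xs   = contradiction sb′ (common⇒≁ xs xb′)

  γg≤γ : γg G ≤ γ G
  γg≤γ = bound n refl
    where
    -- Matching on the fuel provides a vertex `zero` as the default of `argmax`; without vertices no
    -- move is made.
    bound : ∀ k → k ≡ n → movesLeft k G Dominator ∅ ≤ γ G
    bound zero    _    = z≤n
    bound (suc k) refl =
      let S , dom , ∣S∣≡γ   = minimum-dominating G
          S′ , covers , S′< = smaller-cover dom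
      in ≤-trans (Dominator-≤ G k (x , v∈N[v] G , ∉⊥))
           (≤-trans (s≤s (movesLeft≤∣cover∣ k Staller _ (q⊆p∪q ∅ _) (covers ∘ (_∘ q⊆p∪q ∅ _))))
                    (≤-trans S′< (≤-reflexive ∣S∣≡γ)))
      where
      x : Fin (suc k)
      x = argmax (λ v → ∣ neighbours G v ∣) zero (allFin (suc k))
      maximum : ∀ v → ∣ neighbours G v ∣ ≤ ∣ neighbours G x ∣
      maximum v = All.lookup
        (f[xs]≤f[argmax] {f = λ v → ∣ neighbours G v ∣} zero (allFin (suc k))) (∈-allFin v)
      open MaximumDegree x maximum

-- Minimally imperfect graphs

-- Excludes both P₅ and C₅ as induced subgraphs: the adjacency of a and e is left open.
WalkFree : Graph n → Set
WalkFree H = ∀ a b → Adj H a b → ∀ c → Adj H b c → ∀ d → Adj H c d → ¬ Adj H a d →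
  ∀ e → Adj H d e → Adj H b e

-- Quantifiers and adjacency conditions alternate, so a partial walk is discarded as soon as one
-- condition fails.
walkFree? : (H : Graph n) → Dec (WalkFree H)
walkFree? H =
  all? λ a → all? λ b → T? (adj H a b) →-dec
  (all? λ c → T? (adj H b c) →-dec
  (all? λ d → T? (adj H c d) →-dec (¬? (T? (adj H a d)) →-dec
  (all? λ e → T? (adj H d e) →-dec T? (adj H b e)))))

triangleFree? : (H : Graph n) → Dec (TriangleFree H)
triangleFree? H = all? λ u → all? λ v → all? λ w →
  ¬? (T? (adj H u v) ×-dec (T? (adj H v w) ×-dec T? (adj H u w)))

WalkFree-⊑ : ∀ (H : Graph m) (G : Graph n) → H ⊑ G → WalkFree G → WalkFree H
WalkFree-⊑ H G (ι , agree) walkFree a b ab c bc d cd a≁d e de = down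
  (walkFree _ _ (up ab) _ (up bc) _ (up cd) (a≁d ∘ down) _ (up de))
  where
  up : ∀ {i j} → Adj H i j → Adj G (Injection.to ι i) (Injection.to ι j)
  up {i} {j} = subst T (sym (agree i j))
  down : ∀ {i j} → Adj G (Injection.to ι i) (Injection.to ι j) → Adj H i j
  down {i} {j} = subst T (agree i j)

¬WalkFree-path₅ : ¬ WalkFree (path 5)
¬WalkFree-path₅ walkFree = walkFree 0F 1F _ 2F _ 3F _ (λ ()) 4F _

¬WalkFree-cycle₅ : ¬ WalkFree (cycle 5)
¬WalkFree-cycle₅ walkFree = walkFree 0F 1F _ 2F _ 3F _ (λ ()) 4F _

-- The field `proper` replaces perfection of the proper induced subgraphs, which then follows from
-- `γg≤γ`.
record Critical {n} (H : Graph n) : Set where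
  field
    triangle-free : TriangleFree H
    imperfect     : γ H < γg H
    proper        : ∀ {k} (K : Graph k) → K ⊑ H → k < n → ¬ Obstructed K

-- Criticality of the eight graphs

small⇒unobstructed : ∀ (K : Graph k) → k < 5 → ¬ Obstructed K
small⇒unobstructed K k<5 (inj₁ p)              = <⇒≱ k<5 (⊑⇒≤ (path 5) K p)
small⇒unobstructed K k<5 (inj₂ (inj₁ c))       = <⇒≱ k<5 (⊑⇒≤ (cycle 5) K c)
small⇒unobstructed K k<5 (inj₂ (inj₂ (i , f))) =
  <⇒≱ k<5 (≤-trans (n≤1+n 5) (⊑⇒≤ (ℱ i) K f))

path₅-critical : Critical (path 5)
path₅-critical = record
  { triangle-free = from-yes (triangleFree? (path 5))
  ; imperfect     = from-yes (γ (path 5) <? γg (path 5))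
  ; proper        = λ K _ → small⇒unobstructed K
  }

cycle₅-critical : Critical (cycle 5)
cycle₅-critical = record
  { triangle-free = from-yes (triangleFree? (cycle 5))
  ; imperfect     = from-yes (γ (cycle 5) <? γg (cycle 5))
  ; proper        = λ K _ → small⇒unobstructed K
  }

ℱ-triangleFree : ∀ i → TriangleFree (ℱ i)
ℱ-triangleFree = from-yes (all? λ i → triangleFree? (ℱ i))

ℱ-walkFree : ∀ i → WalkFree (ℱ i)
ℱ-walkFree = from-yes (all? λ i → walkFree? (ℱ i))

ℱ-imperfect : ∀ i → γ (ℱ i) < γg (ℱ i)
ℱ-imperfect = from-yes (all? λ i → γ (ℱ i) <? γg (ℱ i))

ℱ-critical : ∀ i → Critical (ℱ i)
ℱ-critical i = record
  { triangle-free = ℱ-triangleFree i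
  ; imperfect     = ℱ-imperfect i
  ; proper        = proper
  }
  where
  -- Counting vertices excludes every `ℱ j`; the five-vertex graphs P₅ and C₅ are excluded by
  -- `WalkFree`, which passes to induced subgraphs.
  proper : ∀ {k} (K : Graph k) → K ⊑ ℱ i → k < 6 → ¬ Obstructed K
  proper K K⊑F _ (inj₁ p) =
    ¬WalkFree-path₅ (WalkFree-⊑ (path 5) (ℱ i) (⊑-trans (path 5) K (ℱ i) p K⊑F) (ℱ-walkFree i))
  proper K K⊑F _ (inj₂ (inj₁ c)) =
    ¬WalkFree-cycle₅ (WalkFree-⊑ (cycle 5) (ℱ i) (⊑-trans (cycle 5) K (ℱ i) c K⊑F) (ℱ-walkFree i))
  proper K _ k<6 (inj₂ (inj₂ (j , f))) = <⇒≱ k<6 (⊑⇒≤ (ℱ j) K f)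

Critical⇒minimallyImperfect : ∀ (G : Graph n) (H : Graph m) → Critical H → G ≅ H →
  TriangleFree G × MinimallyImperfect G
Critical⇒minimallyImperfect {n} {m} G H critical G≅H@(π , _) =
  G-triangleFree , minimal , subst₂ _<_ (sym (γ-iso G H G≅H)) (sym (γg-iso G H G≅H)) imperfect
  where
  open Critical critical
  G-triangleFree : TriangleFree G
  G-triangleFree = TriangleFree-⊑ G H (≅⇒⊑ G H G≅H) triangle-free
  minimal : ∀ {l} .{{_ : NonZero l}} (ι : Fin l ↣ Fin n) → l < n → Perfect (induced G ι)
  minimal ι l<n {k} κ = ≤-antisym
    (γg≤γ K (TriangleFree-⊑ K G K⊑G G-triangleFree)
            (proper K (⊑-trans K G H K⊑G (≅⇒⊑ G H G≅H)) k<m))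
    (γ≤γg K)
    where
    K : Graph k
    K = induced (induced G ι) κ
    -- Inducing twice is by definition inducing along the composite injection.
    K⊑G : K ⊑ G
    K⊑G = induced-⊑ G (ι ↣-∘ κ)
    k<m : k < m
    k<m = subst (k <_) (↔⇒≡ π) (≤-<-trans (injective⇒≤ (Injection.injective κ)) l<n)

-- Punching out a missed `y` would inject `Fin (suc n)` into `Fin n`.
injective⇒surjective : ∀ (ι : Fin n ↣ Fin n) y → ∃ λ i → Injection.to ι i ≡ y
injective⇒surjective {suc n} ι y with any? (λ i → Injection.to ι i ≟ y)
... | yes hit = hit
... | no  y∉  = contradiction
  (injective⇒≤ (λ {i} {j} eq → Injection.injective ι
    (punchOut-injective (λ y≡ → y∉ (i , sym y≡)) (λ y≡ → y∉ (j , sym y≡)) eq)))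
  (<⇒≱ ≤-refl)

spanning-⊑⇒≅ : ∀ (H G : Graph n) → H ⊑ G → H ≅ G
spanning-⊑⇒≅ H G (ι , agree) =
  permutation to (proj₁ ∘ onto) (proj₂ ∘ onto) (λ i → injective (proj₂ (onto (to i)))) ,
  λ u v → sym (agree u v)
  where
  open Injection ι using (to; injective)
  onto = injective⇒surjective ι

-- A copy of `H` on fewer vertices would be a proper induced subgraph of `G`, hence perfect,
-- contradicting the imperfection of `H`.
minimallyImperfect-⊑⇒≅ : ∀ (G : Graph n) (H : Graph m) .{{_ : NonZero m}} →
  MinimallyImperfect G → γ H < γg H → H ⊑ G → G ≅ H
minimallyImperfect-⊑⇒≅ {n} {m} G H (minimal , _) γ<γg H⊑G@(ι , agree)
  with m≤n⇒m<n∨m≡n (⊑⇒≤ H G H⊑G)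
... | inj₂ refl = ≅-sym H G (spanning-⊑⇒≅ H G H⊑G)
... | inj₁ m<n  = contradiction γ<γg (<-irrefl
  (trans (γ-iso H K H≅K) (trans (sym (minimal ι m<n κ)) (sym (γg-iso H K H≅K)))))
  where
  -- Perfection is applied to the copy as an induced subgraph of itself.
  κ : Fin m ↣ Fin m
  κ = ↣-id (Fin m)
  K : Graph m
  K = induced (induced G ι) κ
  H≅K : H ≅ K
  H≅K = idₚ , λ u v → sym (agree u v)

theorem4p6 : ∀ (n : ℕ) .{{_ : NonZero n}} (G : Graph n) →
    (TriangleFree G × MinimallyImperfect G) ⇔
    (G ≅ path 5 ⊎ G ≅ cycle 5 ⊎ (∃ λ i → G ≅ ℱ i))
theorem4p6 n G = mk⇔ classify λ where
    (inj₁ G≅P)              → Critical⇒minimallyImperfect G (path 5) path₅-critical G≅P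
    (inj₂ (inj₁ G≅C))       → Critical⇒minimallyImperfect G (cycle 5) cycle₅-critical G≅C
    (inj₂ (inj₂ (i , G≅F))) → Critical⇒minimallyImperfect G (ℱ i) (ℱ-critical i) G≅F
  where
  classify : TriangleFree G × MinimallyImperfect G →
    G ≅ path 5 ⊎ G ≅ cycle 5 ⊎ (∃ λ i → G ≅ ℱ i)
  classify (triangleFree , mi@(_ , γ<γg)) with obstructed? G
  ... | no  unobstructed = contradiction (γg≤γ G triangleFree unobstructed) (<⇒≱ γ<γg)
  ... | yes obstructed   = Sum.map
    (minimallyImperfect-⊑⇒≅ G (path 5) mi (Critical.imperfect path₅-critical))
    (Sum.map
      (minimallyImperfect-⊑⇒≅ G (cycle 5) mi (Critical.imperfect cycle₅-critical))
      (λ (i , F⊑G) → i , minimallyImperfect-⊑⇒≅ G (ℱ i) mi (ℱ-imperfect i) F⊑G))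
    obstructed
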